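{- Let \(m\) be a positive integer that is not a perfect square, and let \(a,b,c\) be positive integers with \(\gcd(a,b^2-c^2m)=1\). Then \[Frob(a,\,b+c\sqrt m)=(a-1)(b+c\sqrt m-1)(1+\sqrt m)+\mathbb N[\sqrt m].\]
   Context: \(\mathbb N\) denotes the set of non-negative integers. \(\mathbb Z[\sqrt m]=\{u+v\sqrt m\mid u,v\in\mathbb Z\}\) and \(\mathbb N[\sqrt m]=\{u+v\sqrt m\mid u,v\in\mathbb N\}\). For \(\alpha_1,\alpha_2\in\mathbb Z[\sqrt m]\), \(SG(\alpha_1,\alpha_2)=\{\lambda_1\alpha_1+\lambda_2\alpha_2\mid \lambda_1,\lambda_2\in\mathbb N[\sqrt m]\}\) and \(Frob(\alpha_1,\alpha_2)=\{w\in\mathbb Z[\sqrt m]\mid w+\mathbb N[\sqrt m]\subseteq SG(\alpha_1,\alpha_2)\}\). -}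

module Defs where

open import Data.Nat using (ℕ)
open import Data.Integer using (ℤ; +_; 0ℤ; 1ℤ; _+_; _-_; _*_)
open import Data.Product using (∃; ∃₂; _×_)
open import Level using (0ℓ)
open import Relation.Binary.PropositionalEquality using (_≡_)
open import Relation.Unary using (Pred; _∈_; _⊆_)

PerfectSquare : Pred ℕ 0ℓ
PerfectSquare m = ∃ λ k → m ≡ k Data.Nat.* k

-- u +√ v stands for u + v√m.  When m is not a perfect square, 1 and √m are
-- linearly independent over ℤ, so componentwise equality of pairs is equality
-- in ℤ[√m].
infix 5 _+√_
record ℤ[√_] (m : ℕ) : Set where
  constructor _+√_
  field
    rat : ℤ
    irr : ℤ

open ℤ[√_] public

module _ {m : ℕ} where

  infixl 6 _⊕_ _⊖_
  infixl 7 _⊗_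

  _⊕_ : ℤ[√ m ] → ℤ[√ m ] → ℤ[√ m ]
  (u +√ v) ⊕ (u′ +√ v′) = (u + u′) +√ (v + v′)

  _⊖_ : ℤ[√ m ] → ℤ[√ m ] → ℤ[√ m ]
  (u +√ v) ⊖ (u′ +√ v′) = (u - u′) +√ (v - v′)

  _⊗_ : ℤ[√ m ] → ℤ[√ m ] → ℤ[√ m ]
  (u +√ v) ⊗ (u′ +√ v′) = (u * u′ + v * v′ * + m) +√ (u * v′ + v * u′)

  ι : ℤ → ℤ[√ m ]
  ι u = u +√ 0ℤ

  √m : ℤ[√ m ]
  √m = 0ℤ +√ 1ℤ

ℕ[√_] : (m : ℕ) → Pred ℤ[√ m ] 0ℓ
ℕ[√ m ] w = ∃₂ λ (u v : ℕ) → w ≡ ((+ u) +√ (+ v))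

module _ {m : ℕ} where

  infixl 6 _⊕ₛ_

  _⊕ₛ_ : ℤ[√ m ] → Pred ℤ[√ m ] 0ℓ → Pred ℤ[√ m ] 0ℓ
  (w ⊕ₛ S) z = ∃ λ s → s ∈ S × z ≡ w ⊕ s

  SG : ℤ[√ m ] → ℤ[√ m ] → Pred ℤ[√ m ] 0ℓ
  SG α₁ α₂ z = ∃₂ λ λ₁ λ₂ → λ₁ ∈ ℕ[√ m ] × λ₂ ∈ ℕ[√ m ] × z ≡ λ₁ ⊗ α₁ ⊕ λ₂ ⊗ α₂

  Frob : ℤ[√ m ] → ℤ[√ m ] → Pred ℤ[√ m ] 0ℓ
  Frob α₁ α₂ w = w ⊕ₛ ℕ[√ m ] ⊆ SG α₁ α₂

{-# OPTIONS --safe #-}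

-- Put α = b + c√m.  The rational and irrational parts of x + y√m times α are
-- x b + y c m and x c + y b, and the determinant b² − c² m of this system is
-- invertible modulo a.  Hence every u + v√m determines x and y uniquely modulo a.
-- The residues 0 ≤ x, y ≤ a − 1 minimise both parts simultaneously, so u + v√m
-- lies in the semigroup iff it is at least that minimum in each part.  The largest
-- minima, (a − 1)(b + c m) and (a − 1)(c + b), are those of the class
-- x ≡ y ≡ −1; as the parts only move in steps of a, reaching each of them minus
-- (a − 1) is enough for every class and, because of this last one, necessary.
module Submission where

open import Data.Nat using (ℕ; suc; _>_)
open import Data.Integer using (ℤ; +_; -[1+_]; +[1+_]; 0ℤ; 1ℤ; -1ℤ; _+_; _-_; -_; _*_; _^_; _≤_; ∣_∣; pred; +≤+; -≤+)
open import Data.Integer.GCD using (gcd)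
open import Relation.Binary.PropositionalEquality using (_≡_; refl; sym; trans; cong; cong₂; subst; module ≡-Reasoning)
open import Relation.Nullary using (¬_; yes; no; contradiction)
open import Relation.Unary using (_≐_; _∈_)
open import Data.Product using (∃; ∃₂; _×_; _,_; proj₁; proj₂)
open import Data.Sum using (inj₁; inj₂)
open import Data.Integer.DivMod using (_%ℕ_; _/ℕ_; n%ℕd<d; a≡a%ℕn+[a/ℕn]*n)
open import Data.Integer.Divisibility.Signed using (_∣_; divides; ∣⇒∣ᵤ)
open import Data.Integer.Properties
open import Data.Integer.Tactic.RingSolver using (solve-∀)
open import Data.Nat.Coprimality using (gcd≡1⇒coprime; coprime-Bézout)
import Data.Nat as ℕ
import Data.Nat.Divisibility as ℕ
import Data.Nat.GCD as ℕ
import Data.Nat.Properties as ℕ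
open import Defs

-- Integer inequalities and Bézout identities.

i≤j⇒∃[n]j≡i+n : ∀ {i j} → i ≤ j → ∃ λ (n : ℕ) → j ≡ i + + n
i≤j⇒∃[n]j≡i+n {i} {j} i≤j = ∣ j - i ∣ , (begin
  j                 ≡⟨ lemma i j ⟩
  i + (j - i)       ≡⟨ cong (λ z → i + z) (0≤i⇒+∣i∣≡i (i≤j⇒0≤j-i i≤j)) ⟨
  i + + ∣ j - i ∣   ∎)
  where
  open ≡-Reasoning
  lemma : ∀ i j → j ≡ i + (j - i)
  lemma = solve-∀

i≤+∣i∣ : ∀ i → i ≤ + ∣ i ∣
i≤+∣i∣ (+ n)    = ≤-refl
i≤+∣i∣ -[1+ n ] = -≤+

i≰pred[i] : ∀ {i} → ¬ (i ≤ pred i)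
i≰pred[i] i≤ = ≤⇒≯ i≤ (i≤pred[j]⇒i<j ≤-refl)

-- Over ℕ the Bézout identity has two orientations, to avoid subtraction; negative coefficients
-- merge them. Absolute values enter because the integer `gcd` is taken of them.
bézout-∣∣ : ∀ (i j : ℤ) → gcd i j ≡ 1ℤ → ∃₂ λ x y → x * + ∣ j ∣ + y * + ∣ i ∣ ≡ 1ℤ
bézout-∣∣ i j eq with coprime-Bézout (gcd≡1⇒coprime (+-injective eq))
... | ℕ.Bézout.+- x y eq′ = - + y , + x , (begin
  - + y * + ∣ j ∣ + + x * + ∣ i ∣                   ≡⟨ cong (λ z → - + y * + ∣ j ∣ + z) (pos-* x ∣ i ∣) ⟨
  - + y * + ∣ j ∣ + + (x ℕ.* ∣ i ∣)                 ≡⟨ cong (λ z → - + y * + ∣ j ∣ + + z) eq′ ⟨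
  - + y * + ∣ j ∣ + (1ℤ + + (y ℕ.* ∣ j ∣))          ≡⟨ cong (λ z → - + y * + ∣ j ∣ + (1ℤ + z)) (pos-* y ∣ j ∣) ⟩
  - + y * + ∣ j ∣ + (1ℤ + + y * + ∣ j ∣)            ≡⟨ lemma (+ y) (+ ∣ j ∣) 1ℤ ⟩
  1ℤ                                                ∎)
  where
  open ≡-Reasoning
  lemma : ∀ y d e → - y * d + (e + y * d) ≡ e
  lemma = solve-∀
... | ℕ.Bézout.-+ x y eq′ = + y , - + x , (begin
  + y * + ∣ j ∣ + - + x * + ∣ i ∣                   ≡⟨ cong (_+ - + x * + ∣ i ∣) (pos-* y ∣ j ∣) ⟨
  + (y ℕ.* ∣ j ∣) + - + x * + ∣ i ∣                 ≡⟨ cong (λ z → + z + - + x * + ∣ i ∣) eq′ ⟨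
  1ℤ + + (x ℕ.* ∣ i ∣) + - + x * + ∣ i ∣            ≡⟨ cong (λ z → 1ℤ + z + - + x * + ∣ i ∣) (pos-* x ∣ i ∣) ⟩
  1ℤ + + x * + ∣ i ∣ + - + x * + ∣ i ∣              ≡⟨ lemma (+ x) (+ ∣ i ∣) 1ℤ ⟩
  1ℤ                                                ∎)
  where
  open ≡-Reasoning
  lemma : ∀ x d e → e + x * d + - x * d ≡ e
  lemma = solve-∀

-- The sign lost in `∣ j ∣` moves into the coefficient; this matters because b² - c² m may be
-- negative.
bézout : ∀ (n : ℕ) (j : ℤ) → gcd (+ n) j ≡ 1ℤ → ∃₂ λ x y → x * j + y * + n ≡ 1ℤ
bézout n j eq with bézout-∣∣ (+ n) j eq | +∣i∣≡i⊎+∣i∣≡-i j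
... | x , y , eq′ | inj₁ ∣j∣≡j  = x , y , trans (cong (λ d → x * d + y * + n) (sym ∣j∣≡j)) eq′
... | x , y , eq′ | inj₂ ∣j∣≡-j = - x , y , trans (lemma x y j (+ n)) (trans (cong (λ d → x * d + y * + n) (sym ∣j∣≡-j)) eq′)
  where
  lemma : ∀ x y j n → - x * j + y * n ≡ x * - j + y * n
  lemma = solve-∀

-- The threshold in a single coordinate.

module _ (a′ : ℕ) where

  private
    a : ℕ
    a = suc a′

  -- The class x ≡ y ≡ -1 has minimum a′ (p + q), and its next lower value is a′ (p + q) - a. The
  -- threshold is one more than that value.
  bound : ℕ → ℕ → ℤ
  bound p q = + a′ * (+ p + + q - 1ℤ)

  bound-shift : ∀ p q → + a * -1ℤ + + a′ * (+ p + + q) ≡ pred (bound p q)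
  bound-shift p q = lemma (+ a′) (+ p) (+ q)
    where
    lemma : ∀ a′ p q → (1ℤ + a′) * -1ℤ + a′ * (p + q) ≡ -1ℤ + a′ * (p + q - 1ℤ)
    lemma = solve-∀

  -- If `i` were at most -1, the coefficients being at most `a′` would keep the value at or below
  -- `pred (bound p q)`.
  bound≤⇒0≤multiple : ∀ p q {x y i} → x ℕ.≤ a′ → y ℕ.≤ a′ →
    bound p q ≤ + a * i + (+ x * + p + + y * + q) → 0ℤ ≤ i
  bound≤⇒0≤multiple p q {x} {y} {i} x≤ y≤ h =
    i<j⇒suc[i]≤j (*-cancelˡ-<-nonNeg { -1ℤ} {i} (+ a) (≰⇒> λ ai≤-a → i≰pred[i] (step ai≤-a)))
    where
    open ≤-Reasoning
    step : + a * i ≤ + a * -1ℤ → bound p q ≤ pred (bound p q)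
    step ai≤-a = begin
      bound p q                                    ≤⟨ h ⟩
      + a * i + (+ x * + p + + y * + q)            ≤⟨ +-mono-≤ ai≤-a (+-mono-≤ (*-monoʳ-≤-nonNeg (+ p) (+≤+ x≤)) (*-monoʳ-≤-nonNeg (+ q) (+≤+ y≤))) ⟩
      + a * -1ℤ + (+ a′ * + p + + a′ * + q)        ≡⟨ cong (λ z → + a * -1ℤ + z) (*-distribˡ-+ (+ a′) (+ p) (+ q)) ⟨
      + a * -1ℤ + + a′ * (+ p + + q)               ≡⟨ bound-shift p q ⟩
      pred (bound p q)                             ∎

  bound≤ : ∀ p q {x y} (i : ℕ) → a′ ℕ.≤ x → a′ ℕ.≤ y →
    bound p q ≤ + a * + i + (+ x * + p + + y * + q)
  bound≤ p q {x} {y} i a′≤x a′≤y = begin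
    + a′ * (+ p + + q - 1ℤ)                        ≤⟨ *-monoˡ-≤-nonNeg (+ a′) (i≤j⇒i-k≤j 1ℤ ≤-refl) ⟩
    + a′ * (+ p + + q)                             ≡⟨ *-distribˡ-+ (+ a′) (+ p) (+ q) ⟩
    + a′ * + p + + a′ * + q                        ≤⟨ +-mono-≤ (*-monoʳ-≤-nonNeg (+ p) (+≤+ a′≤x)) (*-monoʳ-≤-nonNeg (+ q) (+≤+ a′≤y)) ⟩
    + x * + p + + y * + q                          ≤⟨ i≤j+i _ (+ (a ℕ.* i)) ⟩
    + (a ℕ.* i) + (+ x * + p + + y * + q)          ≡⟨ cong (_+ (+ x * + p + + y * + q)) (pos-* a i) ⟩
    + a * + i + (+ x * + p + + y * + q)            ∎
    where open ≤-Reasoning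

  -- The class x ≡ y ≡ -1 has members above any integer, so one coordinate can be tested while the
  -- other is kept large.
  i≤a∣i∣+ : ∀ i p q → i ≤ + a * + ∣ i ∣ + + a′ * (+ p + + q)
  i≤a∣i∣+ i p q = begin
    i                                                 ≤⟨ i≤+∣i∣ i ⟩
    + ∣ i ∣                                           ≤⟨ +≤+ (ℕ.≤-trans (ℕ.m≤n*m ∣ i ∣ a) (ℕ.m≤m+n _ _)) ⟩
    + (a ℕ.* ∣ i ∣) + + (a′ ℕ.* (p ℕ.+ q))            ≡⟨ cong₂ _+_ (pos-* a ∣ i ∣) (pos-* a′ (p ℕ.+ q)) ⟩
    + a * + ∣ i ∣ + + a′ * (+ p + + q)                ∎
    where open ≤-Reasoning

  -- The two-coordinate linear system modulo a.

  module _ (p q r s : ℕ) where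

    -- Semigroup membership in coordinates: i + j√m multiplies a and x + y√m multiplies α, when p,
    -- q, r, s are b, c m, c, b.
    Rep : ℤ → ℤ → Set
    Rep u v = ∃₂ λ (i j : ℕ) → ∃₂ λ (x y : ℕ) →
      u ≡ + a * + i + (+ x * + p + + y * + q) × v ≡ + a * + j + (+ x * + r + + y * + s)

    module _ (e k : ℤ) (inv : e * (+ p * + s - + q * + r) + k * + a ≡ 1ℤ) where

      -- Cramer's rule: `inv` makes `e` an inverse of the determinant modulo a, and the determinant
      -- times x or y is a combination of the two left sides, hence a multiple of a.
      ∣-kernel : ∀ {x y i j} → x * + p + y * + q ≡ + a * i → x * + r + y * + s ≡ + a * j →
        (+ a ∣ x) × (+ a ∣ y)
      ∣-kernel {x} {y} {i} {j} eq₁ eq₂ =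
        divides (e * (+ s * i - + q * j) + k * x) (begin
          x                                                                          ≡⟨ *-identityʳ x ⟨
          x * 1ℤ                                                                     ≡⟨ cong (x *_) inv ⟨
          x * (e * (+ p * + s - + q * + r) + k * + a)                                ≡⟨ lemma₁ x y e k (+ a) (+ p) (+ q) (+ r) (+ s) ⟩
          e * (+ s * (x * + p + y * + q) - + q * (x * + r + y * + s)) + k * x * + a  ≡⟨ cong₂ (λ f g → e * (+ s * f - + q * g) + k * x * + a) eq₁ eq₂ ⟩
          e * (+ s * (+ a * i) - + q * (+ a * j)) + k * x * + a                      ≡⟨ lemma₃ e k x (+ a) (+ s) (+ q) i j ⟩
          (e * (+ s * i - + q * j) + k * x) * + a                                    ∎) ,
        divides (e * (+ p * j - + r * i) + k * y) (begin
          y                                                                          ≡⟨ *-identityʳ y ⟨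
          y * 1ℤ                                                                     ≡⟨ cong (y *_) inv ⟨
          y * (e * (+ p * + s - + q * + r) + k * + a)                                ≡⟨ lemma₂ x y e k (+ a) (+ p) (+ q) (+ r) (+ s) ⟩
          e * (+ p * (x * + r + y * + s) - + r * (x * + p + y * + q)) + k * y * + a  ≡⟨ cong₂ (λ f g → e * (+ p * g - + r * f) + k * y * + a) eq₁ eq₂ ⟩
          e * (+ p * (+ a * j) - + r * (+ a * i)) + k * y * + a                      ≡⟨ lemma₃ e k y (+ a) (+ p) (+ r) j i ⟩
          (e * (+ p * j - + r * i) + k * y) * + a                                    ∎)
        where
        open ≡-Reasoning
        lemma₁ : ∀ x y e k a p q r s → x * (e * (p * s - q * r) + k * a)
          ≡ e * (s * (x * p + y * q) - q * (x * r + y * s)) + k * x * a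
        lemma₁ = solve-∀
        lemma₂ : ∀ x y e k a p q r s → y * (e * (p * s - q * r) + k * a)
          ≡ e * (p * (x * r + y * s) - r * (x * p + y * q)) + k * y * a
        lemma₂ = solve-∀
        lemma₃ : ∀ e k x a s q i j → e * (s * (a * i) - q * (a * j)) + k * x * a
          ≡ (e * (s * i - q * j) + k * x) * a
        lemma₃ = solve-∀

      reduced-solution : ∀ u v → ∃₂ λ (x y : ℕ) → ∃₂ λ (i j : ℤ) → x ℕ.≤ a′ × y ℕ.≤ a′ ×
        u ≡ + a * i + (+ x * + p + + y * + q) × v ≡ + a * j + (+ x * + r + + y * + s)
      reduced-solution u v =
        X %ℕ a , Y %ℕ a ,
        -- The multiples of a collect the Bézout remainder and the quotients discarded when X and Y
        -- are reduced.
        u * k + (X /ℕ a * + p + Y /ℕ a * + q) , v * k + (X /ℕ a * + r + Y /ℕ a * + s) ,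
        ℕ.s≤s⁻¹ (n%ℕd<d X a) , ℕ.s≤s⁻¹ (n%ℕd<d Y a) ,
        coordinate u (+ p) (+ q) (lemma₁ u v e (+ p) (+ q) (+ r) (+ s)) ,
        coordinate v (+ r) (+ s) (lemma₂ u v e (+ p) (+ q) (+ r) (+ s))
        where
        open ≡-Reasoning
        X Y : ℤ
        -- Cramer's rule with `e` in place of the inverse determinant.
        X = e * (u * + s - v * + q)
        Y = e * (v * + p - u * + r)
        lemma₁ : ∀ u v e p q r s → u * (e * (p * s - q * r))
          ≡ e * (u * s - v * q) * p + e * (v * p - u * r) * q
        lemma₁ = solve-∀
        lemma₂ : ∀ u v e p q r s → v * (e * (p * s - q * r))
          ≡ e * (u * s - v * q) * r + e * (v * p - u * r) * s
        lemma₂ = solve-∀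
        lemma₃ : ∀ w k a x x′ y y′ f g → (x + x′ * a) * f + (y + y′ * a) * g + w * (k * a)
          ≡ a * (w * k + (x′ * f + y′ * g)) + (x * f + y * g)
        lemma₃ = solve-∀
        coordinate : ∀ w f g → w * (e * (+ p * + s - + q * + r)) ≡ X * f + Y * g →
          w ≡ + a * (w * k + (X /ℕ a * f + Y /ℕ a * g)) + (+ (X %ℕ a) * f + + (Y %ℕ a) * g)
        coordinate w f g eq = begin
          w                                                              ≡⟨ *-identityʳ w ⟨
          w * 1ℤ                                                         ≡⟨ cong (w *_) inv ⟨
          w * (e * (+ p * + s - + q * + r) + k * + a)                    ≡⟨ *-distribˡ-+ w _ _ ⟩
          w * (e * (+ p * + s - + q * + r)) + w * (k * + a)              ≡⟨ cong (_+ w * (k * + a)) eq ⟩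
          X * f + Y * g + w * (k * + a)                                  ≡⟨ cong₂ (λ X Y → X * f + Y * g + w * (k * + a)) (a≡a%ℕn+[a/ℕn]*n X a) (a≡a%ℕn+[a/ℕn]*n Y a) ⟩
          (+ (X %ℕ a) + X /ℕ a * + a) * f + (+ (Y %ℕ a) + Y /ℕ a * + a) * g + w * (k * + a)
            ≡⟨ lemma₃ w k (+ a) (+ (X %ℕ a)) (X /ℕ a) (+ (Y %ℕ a)) (Y /ℕ a) f g ⟩
          + a * (w * k + (X /ℕ a * f + Y /ℕ a * g)) + (+ (X %ℕ a) * f + + (Y %ℕ a) * g) ∎

      -- One reduced pair x, y serves both coordinates, and each threshold makes its own multiple of
      -- a nonnegative.
      bound≤⇒Rep : ∀ {u v} → bound p q ≤ u → bound r s ≤ v → Rep u v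
      bound≤⇒Rep {u} {v} hu hv with reduced-solution u v
      ... | x , y , i , j , x≤ , y≤ , refl , refl =
        ∣ i ∣ , ∣ j ∣ , x , y ,
        cong (λ i → + a * i + (+ x * + p + + y * + q)) (sym (0≤i⇒+∣i∣≡i (bound≤⇒0≤multiple p q {i = i} x≤ y≤ hu))) ,
        cong (λ j → + a * j + (+ x * + r + + y * + s)) (sym (0≤i⇒+∣i∣≡i (bound≤⇒0≤multiple r s {i = j} x≤ y≤ hv)))

      -- The hypothesis on u and v says that the coefficients of α are ≡ −1 modulo a.
      Rep⇒bound≤ : ∀ i₀ j₀ {u v} → u ≡ + a * i₀ + + a′ * (+ p + + q) → v ≡ + a * j₀ + + a′ * (+ r + + s) →
        Rep u v → bound p q ≤ u × bound r s ≤ v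
      Rep⇒bound≤ i₀ j₀ refl refl (i , j , x , y , equ , eqv) =
        subst (bound p q ≤_) (sym equ) (bound≤ p q i a′≤x a′≤y) ,
        subst (bound r s ≤_) (sym eqv) (bound≤ r s j a′≤x a′≤y)
        where
        open ≡-Reasoning
        lemma₁ : ∀ a′ i x y p q → (1ℤ + x) * p + (1ℤ + y) * q
          ≡ (1ℤ + a′) * i + (x * p + y * q) + (p + q - (1ℤ + a′) * i)
        lemma₁ = solve-∀
        lemma₂ : ∀ a′ i₀ i p q → (1ℤ + a′) * i₀ + a′ * (p + q) + (p + q - (1ℤ + a′) * i)
          ≡ (1ℤ + a′) * (i₀ - i + (p + q))
        lemma₂ = solve-∀
        -- Raising both coefficients by one turns the class -1 into the class 0, where `∣-kernel`
        -- applies.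
        shift : ∀ i₀ i p q → + a * i₀ + + a′ * (p + q) ≡ + a * + i + (+ x * p + + y * q) →
          +[1+ x ] * p + +[1+ y ] * q ≡ + a * (i₀ - + i + (p + q))
        shift i₀ i p q eq = begin
          +[1+ x ] * p + +[1+ y ] * q                                          ≡⟨ lemma₁ (+ a′) (+ i) (+ x) (+ y) p q ⟩
          + a * + i + (+ x * p + + y * q) + (p + q - + a * + i)                ≡⟨ cong (_+ (p + q - + a * + i)) eq ⟨
          + a * i₀ + + a′ * (p + q) + (p + q - + a * + i)                      ≡⟨ lemma₂ (+ a′) i₀ (+ i) p q ⟩
          + a * (i₀ - + i + (p + q))                                           ∎
        a∣ : (+ a ∣ +[1+ x ]) × (+ a ∣ +[1+ y ])
        a∣ = ∣-kernel (shift i₀ i (+ p) (+ q) equ) (shift j₀ j (+ r) (+ s) eqv)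
        a′≤x : a′ ℕ.≤ x
        -- A divisor of the positive number 1 + x is at most 1 + x.
        a′≤x = ℕ.s≤s⁻¹ (ℕ.∣⇒≤ (∣⇒∣ᵤ (proj₁ a∣)))
        a′≤y : a′ ℕ.≤ y
        a′≤y = ℕ.s≤s⁻¹ (ℕ.∣⇒≤ (∣⇒∣ᵤ (proj₂ a∣)))

      -- If a coordinate lay below its threshold, the predecessor of the threshold, paired with a
      -- large value in the class -1, would be representable; this would put the threshold below
      -- itself.
      Rep-above⇒bound≤ : ∀ {u v} → (∀ {u′ v′} → u ≤ u′ → v ≤ v′ → Rep u′ v′) →
        bound p q ≤ u × bound r s ≤ v
      Rep-above⇒bound≤ {u} {v} above = bound≤u , bound≤v
        where
        bound≤u : bound p q ≤ u
        bound≤u with bound p q ≤? u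
        ... | yes h = h
        ... | no ¬h = contradiction
          -- The multiplier -1 gives `pred (bound p q)`; the multiplier `∣ v ∣` puts the other
          -- coordinate above v.
          (proj₁ (Rep⇒bound≤ -1ℤ (+ ∣ v ∣) (sym (bound-shift p q)) refl
            (above (i<j⇒i≤pred[j] (≰⇒> ¬h)) (i≤a∣i∣+ v r s))))
          i≰pred[i]
        bound≤v : bound r s ≤ v
        bound≤v with bound r s ≤? v
        ... | yes h = h
        ... | no ¬h = contradiction
          (proj₂ (Rep⇒bound≤ (+ ∣ u ∣) -1ℤ refl (sym (bound-shift r s))
            (above (i≤a∣i∣+ u p q) (i<j⇒i≤pred[j] (≰⇒> ¬h)))))
          i≰pred[i]

-- Translation to ℤ[√m].

module _ {m : ℕ} where

  ≤⇒∈⊕ₛ : ∀ {w z : ℤ[√ m ]} → rat w ≤ rat z → irr w ≤ irr z → z ∈ w ⊕ₛ ℕ[√ m ]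
  ≤⇒∈⊕ₛ hr hi with i≤j⇒∃[n]j≡i+n hr | i≤j⇒∃[n]j≡i+n hi
  ... | x , eqr | y , eqi = (+ x +√ + y) , (x , y , refl) , cong₂ _+√_ eqr eqi

  ∈⊕ₛ⇒≤ : ∀ {w z : ℤ[√ m ]} → z ∈ w ⊕ₛ ℕ[√ m ] → rat w ≤ rat z × irr w ≤ irr z
  ∈⊕ₛ⇒≤ {w} (_ , (x , y , refl) , refl) = i≤i+j (rat w) (+ x) , i≤i+j (irr w) (+ y)

  module _ (a′ b c : ℕ) where

    private
      SGRep : ℤ → ℤ → Set
      SGRep = Rep a′ b (c ℕ.* m) c b

    combination : ∀ i j x y →
      _⊕_ {m} ((i +√ j) ⊗ ι +[1+ a′ ]) ((x +√ y) ⊗ (+ b +√ + c))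
      ≡ ((+[1+ a′ ] * i + (x * + b + y * + (c ℕ.* m))) +√ (+[1+ a′ ] * j + (x * + c + y * + b)))
    combination i j x y = cong₂ _+√_
      (trans (lemma₁ i j x y (+ m) +[1+ a′ ] (+ b) (+ c))
        (cong (λ n → +[1+ a′ ] * i + (x * + b + y * n)) (sym (pos-* c m))))
      (lemma₂ i j x y +[1+ a′ ] (+ b) (+ c))
      where
      lemma₁ : ∀ i j x y m a b c → (i * a + j * 0ℤ * m) + (x * b + y * c * m) ≡ a * i + (x * b + y * (c * m))
      lemma₁ = solve-∀
      lemma₂ : ∀ i j x y a b c → (i * 0ℤ + j * a) + (x * c + y * b) ≡ a * j + (x * c + y * b)
      lemma₂ = solve-∀

    SG⇒Rep : ∀ {u v} → (u +√ v) ∈ SG {m} (ι +[1+ a′ ]) (+ b +√ + c) → SGRep u v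
    SG⇒Rep (_ , _ , (i , j , refl) , (x , y , refl) , eq) =
      i , j , x , y , cong rat eq′ , cong irr eq′
      where eq′ = trans eq (combination (+ i) (+ j) (+ x) (+ y))

    Rep⇒SG : ∀ {u v} → SGRep u v → (u +√ v) ∈ SG {m} (ι +[1+ a′ ]) (+ b +√ + c)
    Rep⇒SG (i , j , x , y , refl , refl) =
      (+ i +√ + j) , (+ x +√ + y) , (i , j , refl) , (x , y , refl) , sym (combination (+ i) (+ j) (+ x) (+ y))

    -- Translates of ℕ[√m] are up-sets of the componentwise order, so membership in `Frob` asks that
    -- every pair above be representable. The determinant is now b² - c² m.
    Frob-≐ : ∀ e k → e * (+ b * + b - + (c ℕ.* m) * + c) + k * +[1+ a′ ] ≡ 1ℤ →
      Frob {m} (ι +[1+ a′ ]) (+ b +√ + c) ≐ (bound a′ b (c ℕ.* m) +√ bound a′ c b) ⊕ₛ ℕ[√ m ]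
    Frob-≐ e k inv = Frob⊆ , ⊆Frob
      where
      Frob⊆ : ∀ {w} → w ∈ Frob (ι +[1+ a′ ]) (+ b +√ + c) → w ∈ (bound a′ b (c ℕ.* m) +√ bound a′ c b) ⊕ₛ ℕ[√ m ]
      Frob⊆ {u +√ v} w∈Frob with Rep-above⇒bound≤ a′ b (c ℕ.* m) c b e k inv {u} {v}
        (λ hu hv → SG⇒Rep (w∈Frob (≤⇒∈⊕ₛ hu hv)))
      ... | hu , hv = ≤⇒∈⊕ₛ hu hv
      ⊆Frob : ∀ {w} → w ∈ (bound a′ b (c ℕ.* m) +√ bound a′ c b) ⊕ₛ ℕ[√ m ] → w ∈ Frob (ι +[1+ a′ ]) (+ b +√ + c)
      ⊆Frob w∈ z∈ with ∈⊕ₛ⇒≤ w∈ | ∈⊕ₛ⇒≤ z∈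
      ... | h₁ , h₂ | h₃ , h₄ = Rep⇒SG (bound≤⇒Rep a′ b (c ℕ.* m) c b e k inv (≤-trans h₁ h₃) (≤-trans h₂ h₄))

    α-normal : ι (+ b) ⊕ ι (+ c) ⊗ √m ≡ (_+√_ {m} (+ b) (+ c))
    α-normal = cong₂ _+√_ (lemma₁ (+ b) (+ c) (+ m)) (lemma₂ (+ c))
      where
      lemma₁ : ∀ b c m → b + (c * 0ℤ + 0ℤ * 1ℤ * m) ≡ b
      lemma₁ = solve-∀
      lemma₂ : ∀ c → 0ℤ + (c * 1ℤ + 0ℤ * 0ℤ) ≡ c
      lemma₂ = solve-∀

    -- Multiplying (b - 1) + c√m by 1 + √m gives the parts b - 1 + c m and b - 1 + c; the factor a -
    -- 1 turns them into the thresholds.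
    corner-normal : (ι +[1+ a′ ] ⊖ ι 1ℤ) ⊗ ((+ b +√ + c) ⊖ ι 1ℤ) ⊗ (ι 1ℤ ⊕ √m)
      ≡ (_+√_ {m} (bound a′ b (c ℕ.* m)) (bound a′ c b))
    corner-normal = cong₂ _+√_
      (trans (lemma₁ (+ a′) (+ b) (+ c) (+ m))
        (cong (λ n → + a′ * (+ b + n - 1ℤ)) (sym (pos-* c m))))
      (lemma₂ (+ a′) (+ b) (+ c) (+ m))
      where
      lemma₁ : ∀ a′ b c m → (a′ * (b - 1ℤ) + 0ℤ * (c - 0ℤ) * m) * 1ℤ + (a′ * (c - 0ℤ) + 0ℤ * (b - 1ℤ)) * 1ℤ * m
        ≡ a′ * (b + c * m - 1ℤ)
      lemma₁ = solve-∀
      lemma₂ : ∀ a′ b c m → (a′ * (b - 1ℤ) + 0ℤ * (c - 0ℤ) * m) * 1ℤ + (a′ * (c - 0ℤ) + 0ℤ * (b - 1ℤ)) * 1ℤ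
        ≡ a′ * (c + b - 1ℤ)
      lemma₂ = solve-∀

norm-normal : ∀ b c m → (+ b) ^ 2 - (+ c) ^ 2 * + m ≡ + b * + b - + (c ℕ.* m) * + c
norm-normal b c m = trans (lemma (+ b) (+ c) (+ m)) (cong (λ n → + b * + b - n * + c) (sym (pos-* c m)))
  where
  lemma : ∀ b c m → b * (b * 1ℤ) - c * (c * 1ℤ) * m ≡ b * b - c * m * c
  -- The factors `1ℤ` in the statement come from unfolding `^ 2`.
  lemma = solve-∀

theorem2 : (m : ℕ) → m > 0 → ¬ PerfectSquare m →
    (a b c : ℕ) → a > 0 → b > 0 → c > 0 →
    gcd (+ a) ((+ b) ^ 2 - (+ c) ^ 2 * + m) ≡ 1ℤ →
    Frob {m} (ι (+ a)) (ι (+ b) ⊕ ι (+ c) ⊗ √m)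
    ≐ ((ι (+ a) ⊖ ι 1ℤ) ⊗ (ι (+ b) ⊕ ι (+ c) ⊗ √m ⊖ ι 1ℤ) ⊗ (ι 1ℤ ⊕ √m)) ⊕ₛ ℕ[√ m ]
theorem2 m _ _ (suc a′) b c _ _ _ coprime
  with bézout (suc a′) (+ b * + b - + (c ℕ.* m) * + c)
    (subst (λ d → gcd +[1+ a′ ] d ≡ 1ℤ) (norm-normal b c m) coprime)
... | e , k , inv =
  -- The outer transport restores α, which also occurs inside the corner; the inner one then
  -- restores the corner.
  subst
    (λ α → Frob {m} (ι +[1+ a′ ]) α ≐ ((ι +[1+ a′ ] ⊖ ι 1ℤ) ⊗ (α ⊖ ι 1ℤ) ⊗ (ι 1ℤ ⊕ √m)) ⊕ₛ ℕ[√ m ])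
    (sym (α-normal a′ b c))
    (subst (λ z → Frob {m} (ι +[1+ a′ ]) (+ b +√ + c) ≐ z ⊕ₛ ℕ[√ m ])
      (sym (corner-normal a′ b c))
      (Frob-≐ a′ b c e k inv))
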